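{- Let $n\ge 3$, $k\ge 1$ and $p\in\{0,1,2\}$. Then \[ \gamma_{\rm S}(C_n,C_{3k+p})\in \begin{cases} \{kn\}, & p=0,\\ \{kn,\;kn+1\}, & p=1,\\ \{kn+\lfloor n/2\rfloor,\; kn+\lfloor n/2\rfloor+1\}, & p=2. \end{cases} \] Moreover, if $n\equiv 0 \pmod 4$, then $\gamma_{\rm S}(C_n,C_{3k+1})=kn$ and $\gamma_{\rm S}(C_n,C_{3k+2})=kn+\lfloor n/2\rfloor$.
   Context: $C_m$ denotes the cycle on $m$ vertices; $\gamma$ denotes the domination number. For graphs $G,H$ and a function $f\colon V(G)\to V(H)$, the Sierpiński product $G\otimes_f H$ is the graph with vertex set $V(G)\times V(H)$ and edges of two types: (type 1) $(g,h)(g,h')$ for every $g\in V(G)$ and every edge $hh'\in E(H)$; (type 2) $(g,f(g'))(g',f(g))$ for every edge $gg'\in E(G)$. The Sierpiński domination number is $\gamma_{\rm S}(G,H)=\min_{f}\gamma(G\otimes_f H)$ over all functions $f\colon V(G)\to V(H)$. -}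

module Defs where

open import Data.Nat using (ℕ; zero; suc; _+_; _*_; _^_; _≤_; z≤n; s≤s)
import Data.Nat.Properties as ℕ
open import Data.Fin as Fin using (Fin; toℕ; finToFun; funToFin)
import Data.Fin.Properties as Fin
open import Data.Fin.Subset using (Subset; ⊤; ∣_∣; _∈_)
open import Data.Fin.Subset.Properties using (_∈?_; ∈⊤; anySubset?)
open import Data.Product using (∃; _×_; _,_; proj₁; proj₂; map₂)
open import Data.Product.Function.NonDependent.Propositional using (_×-↔_)
open import Data.Sum using (_⊎_; inj₁; inj₂; [_,_])
import Data.Sum as Sum
open import Function using (_∘_; _↔_; Inverse; const)
open import Function.Construct.Composition using (_↔-∘_)
open import Function.Construct.Identity using (↔-id)
open import Relation.Binary using (DecidableEquality)
open import Relation.Binary.PropositionalEquality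
  using (_≡_; refl; sym; trans; cong; subst; subst₂; _≗_)
open import Relation.Nullary using (¬_; Dec; yes; no; contradiction; contradiction-irr)
open import Relation.Nullary.Decidable using (map′; _⊎-dec_; _×-dec_)
open import Level using (0ℓ)
open import Relation.Unary using (Pred; Decidable)

IsMinimum : ∀ {ℓ} → Pred ℕ ℓ → Pred ℕ ℓ
IsMinimum P m = P m × (∀ k → P k → m ≤ k)

least : ∀ {ℓ} {P : Pred ℕ ℓ} → Decidable P → ∀ b → P b → ∃ (IsMinimum P)
least P? zero    p = zero , p , λ _ _ → z≤n
least P? (suc b) p with P? zero
... | yes p₀ = zero , p₀ , λ _ _ → z≤n
... | no ¬p₀ with least (P? ∘ suc) b p
...   | m , pₘ , min = suc m , pₘ , λ where
          zero    p₀ → contradiction p₀ ¬p₀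
          (suc k) pₖ → s≤s (min k pₖ)

-- Finite simple graphs; `vertex` makes them nonempty, so that functions
-- V G → V H always exist and the minimum over them is defined.
record Graph : Set₁ where
  infix 4 _~_
  field
    V           : Set
    order       : ℕ
    enumeration : Fin order ↔ V
    vertex      : V
    _~_         : V → V → Set
    _~?_        : ∀ u v → Dec (u ~ v)
    ~-sym       : ∀ {u v} → u ~ v → v ~ u
    ~-irrefl    : ∀ {v} → ¬ (v ~ v)

  open Inverse enumeration public
    using () renaming (to to vertexAt; from to index;
                       strictlyInverseˡ to vertexAt-index;
                       strictlyInverseʳ to index-vertexAt)

  infix 4 _≟_
  _≟_ : DecidableEquality V
  u ≟ v = map′
    (λ e → trans (sym (vertexAt-index u)) (trans (cong vertexAt e) (vertexAt-index v)))
    (cong index) (index u Fin.≟ index v)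

  any? : {P : Pred V 0ℓ} → Decidable P → Dec (∃ P)
  any? {P} P? = map′ (λ (i , p) → vertexAt i , p)
    (λ (v , p) → index v , subst P (sym (vertexAt-index v)) p)
    (Fin.any? (P? ∘ vertexAt))

  all? : {P : Pred V 0ℓ} → Decidable P → Dec (∀ v → P v)
  all? {P} P? = map′ (λ p v → subst P (vertexAt-index v) (p (index v)))
    (_∘ vertexAt) (Fin.all? (P? ∘ vertexAt))

  -- Vertex sets are subsets of the index set Fin order.
  VertexSet : Set
  VertexSet = Subset order

  infix 4 _∈ᵛ_
  _∈ᵛ_ : V → VertexSet → Set
  v ∈ᵛ S = index v ∈ S

  Dominating : VertexSet → Set
  Dominating S = ∀ v → v ∈ᵛ S ⊎ ∃ λ u → u ∈ᵛ S × u ~ v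

  dominating? : Decidable Dominating
  dominating? S = all? λ v →
    (index v ∈? S) ⊎-dec any? λ u → (index u ∈? S) ×-dec (u ~? v)

  DominatedBy : ℕ → Set
  DominatedBy c = ∃ λ S → Dominating S × ∣ S ∣ ≡ c

  minDominating : ∃ (IsMinimum DominatedBy)
  minDominating = least
    (λ c → anySubset? λ S → dominating? S ×-dec (∣ S ∣ ℕ.≟ c))
    _ (⊤ , (λ _ → inj₁ ∈⊤) , refl)

open Graph using (V; DominatedBy)

γ : Graph → ℕ
γ G = proj₁ (Graph.minDominating G)

γ-isMinimum : ∀ G → IsMinimum (DominatedBy G) (γ G)
γ-isMinimum G = proj₂ (Graph.minDominating G)

module _ (G H : Graph) where
  private
    module G = Graph G
    module H = Graph H

  data SierpińskiEdge (f : G.V → H.V) : G.V × H.V → G.V × H.V → Set where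
    type₁ : ∀ g {h h′} → h H.~ h′ → SierpińskiEdge f (g , h) (g , h′)
    type₂ : ∀ {g g′} → g G.~ g′ → SierpińskiEdge f (g , f g′) (g′ , f g)

  edge? : ∀ f u v → Dec (SierpińskiEdge f u v)
  edge? f (g , h) (g′ , h′) = map′ to from
    (((g G.≟ g′) ×-dec (h H.~? h′)) ⊎-dec
     ((g G.~? g′) ×-dec ((h H.≟ f g′) ×-dec (h′ H.≟ f g))))
    where
    to : (g ≡ g′ × h H.~ h′) ⊎ (g G.~ g′ × h ≡ f g′ × h′ ≡ f g) →
         SierpińskiEdge f (g , h) (g′ , h′)
    to (inj₁ (refl , e))        = type₁ g e
    to (inj₂ (e , refl , refl)) = type₂ e

    from : SierpińskiEdge f (g , h) (g′ , h′) →
           (g ≡ g′ × h H.~ h′) ⊎ (g G.~ g′ × h ≡ f g′ × h′ ≡ f g)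
    from (type₁ _ e) = inj₁ (refl , e)
    from (type₂ e)   = inj₂ (e , refl , refl)

  edge-sym : ∀ {f u v} → SierpińskiEdge f u v → SierpińskiEdge f v u
  edge-sym (type₁ g e) = type₁ g (H.~-sym e)
  edge-sym (type₂ e)   = type₂ (G.~-sym e)

  edge-irrefl : ∀ {f u v} → SierpińskiEdge f u v → ¬ (u ≡ v)
  edge-irrefl (type₁ _ e) refl = H.~-irrefl e
  edge-irrefl (type₂ {g} e) eq =
    G.~-irrefl (subst (g G.~_) (sym (cong proj₁ eq)) e)

sierpińskiProduct : (G H : Graph) → (V G → V H) → Graph
sierpińskiProduct G H f = record
  { V           = V G × V H
  ; order       = Graph.order G * Graph.order H
  ; enumeration = (Graph.enumeration G ×-↔ Graph.enumeration H) ↔-∘ Fin.*↔×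
  ; vertex      = Graph.vertex G , Graph.vertex H
  ; _~_         = SierpińskiEdge G H f
  ; _~?_        = edge? G H f
  ; ~-sym       = edge-sym G H
  ; ~-irrefl    = λ e → edge-irrefl G H e refl
  }

syntax sierpińskiProduct G H f = G ⊗[ f ] H

module _ (G H : Graph) where
  private
    module G = Graph G
    module H = Graph H

  edge-cong : ∀ {f f′} → f ≗ f′ → ∀ {u v} →
              SierpińskiEdge G H f u v → SierpińskiEdge G H f′ u v
  edge-cong eq (type₁ g e) = type₁ g e
  edge-cong {f} {f′} eq (type₂ {g} {g′} e) =
    subst₂ (λ h h′ → SierpińskiEdge G H f′ (g , h) (g′ , h′))
      (sym (eq g′)) (sym (eq g)) (type₂ e)

  γ-cong : ∀ {f f′} → f ≗ f′ → γ (G ⊗[ f ] H) ≡ γ (G ⊗[ f′ ] H)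
  γ-cong eq = ℕ.≤-antisym (γ-mono (sym ∘ eq)) (γ-mono eq)
    where
    γ-mono : ∀ {f f′} → f ≗ f′ → γ (G ⊗[ f′ ] H) ≤ γ (G ⊗[ f ] H)
    γ-mono {f} {f′} eq with γ-isMinimum (G ⊗[ f ] H)
    ... | (S , dom , size) , _ = proj₂ (γ-isMinimum (G ⊗[ f′ ] H)) _
      (S , (λ v → Sum.map₂ (map₂ (map₂ (edge-cong eq))) (dom v)) , size)

  SierpińskiValue : ℕ → Set
  SierpińskiValue c = ∃ λ (f : G.V → H.V) → γ (G ⊗[ f ] H) ≡ c

  private
    decode : Fin (H.order ^ G.order) → G.V → H.V
    decode i = H.vertexAt ∘ finToFun i ∘ G.index

    encode : (G.V → H.V) → Fin (H.order ^ G.order)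
    encode f = funToFin (H.index ∘ f ∘ G.vertexAt)

    decode-encode : ∀ f → decode (encode f) ≗ f
    decode-encode f g = trans
      (cong H.vertexAt (Fin.finToFun-funToFin (H.index ∘ f ∘ G.vertexAt) (G.index g)))
      (trans (H.vertexAt-index _) (cong f (G.vertexAt-index g)))

    sierpińskiValue? : Decidable SierpińskiValue
    sierpińskiValue? c = map′ (λ (i , e) → decode i , e)
      (λ (f , e) → encode f , trans (γ-cong (decode-encode f)) e)
      (Fin.any? λ i → γ (G ⊗[ decode i ] H) ℕ.≟ c)

  minSierpińskiValue : ∃ (IsMinimum SierpińskiValue)
  minSierpińskiValue = least sierpińskiValue? _ (const H.vertex , refl)

  γₛ : ℕ
  γₛ = proj₁ minSierpińskiValue

  γₛ-isMinimum : IsMinimum SierpińskiValue γₛ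
  γₛ-isMinimum = proj₂ minSierpińskiValue

-- Next i j says j = i + 1 modulo m.
module _ {m : ℕ} where
  data Next (i j : Fin m) : Set where
    step : suc (toℕ i) ≡ toℕ j → Next i j
    wrap : suc (toℕ i) ≡ m → toℕ j ≡ 0 → Next i j

  next? : ∀ i j → Dec (Next i j)
  next? i j = map′ [ step , (λ (e , e′) → wrap e e′) ]
    (λ where (step e) → inj₁ e ; (wrap e e′) → inj₂ (e , e′))
    ((suc (toℕ i) ℕ.≟ toℕ j) ⊎-dec ((suc (toℕ i) ℕ.≟ m) ×-dec (toℕ j ℕ.≟ 0)))

  CycleEdge : Fin m → Fin m → Set
  CycleEdge i j = Next i j ⊎ Next j i

  next-irrefl : .(3 ≤ m) → ∀ {i : Fin m} → ¬ Next i i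
  next-irrefl _   (step e)    = ℕ.1+n≢n e
  next-irrefl 3≤m (wrap e e₀) = contradiction-irr
    (subst (3 ≤_) (trans (sym e) (cong suc e₀)) 3≤m) λ { (s≤s ()) }

C : (m : ℕ) → .(3 ≤ m) → Graph
C m 3≤m = record
  { V           = Fin m
  ; order       = m
  ; enumeration = ↔-id (Fin m)
  ; vertex      = Fin.fromℕ< {0} (ℕ.≤-trans (s≤s z≤n) 3≤m)
  ; _~_         = CycleEdge
  ; _~?_        = λ i j → next? i j ⊎-dec next? j i
  ; ~-sym       = Sum.swap
  ; ~-irrefl    = [ next-irrefl 3≤m , next-irrefl 3≤m ]
  }

3≤3k+ : ∀ {k} p → 1 ≤ k → 3 ≤ 3 * k + p
3≤3k+ p 1≤k = ℕ.≤-trans (ℕ.*-monoʳ-≤ 3 1≤k) (ℕ.m≤m+n _ p)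

{-# OPTIONS --safe #-}

-- Lower bounds.  A layer, a copy of C_m with m = 3k + p, receives help from
-- outside at no more than two vertices, so it contains at least (m - 2)/3,
-- hence k, vertices of the dominating set.  An edge joining consecutive layers
-- helps at most one of them, so two consecutive layers contain together at
-- least (2m - 3)/3 vertices, that is 2k + 1 for p = 2; this is summed around
-- the cycle.
--
-- Upper bounds.  Layers and values of f repeat with period 4.  For p = 1 each
-- layer takes k vertices missing exactly one, which the preceding layer
-- dominates.  For p = 2 layers alternate between a dominating set of size k + 1
-- and a set of size k missing 0 and 1, which its two neighbours dominate.  When
-- the period does not close up around C_n, layer 0 is replaced by a dominating
-- set of C_m, at the price of one vertex.
module Submission where

open import Defs
open import Data.Nat using (ℕ; zero; suc; _+_; _*_; _≤_; _<_; _%_; ⌊_/2⌋; ⌈_/2⌉; z≤n; s≤s)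
import Data.Nat.Properties as ℕ
open import Data.Nat.Tactic.RingSolver using (solve-∀)
open import Data.Bool using (Bool; true; false; _∧_; not)
open import Data.Fin as Fin
  using (Fin; zero; suc; toℕ; fromℕ; inject₁; combine; remQuot; _↑ˡ_; _↑ʳ_)
import Data.Fin.Properties as Fin
open import Data.Fin.Permutation
  using (Permutation′; _⟨$⟩ʳ_; _⟨$⟩ˡ_; inverseˡ; inverseʳ; flip)
import Data.Fin.Permutation as Perm
open import Data.Fin.Relation.Unary.Top using (view; ‵fromℕ; ‵inject₁; view-fromℕ; view-inject₁)
open import Data.Fin.Subset using (Subset; ∣_∣)
open import Data.Vec using ([]; _∷_; lookup; tabulate)
open import Data.Vec.Properties using ([]=⇒lookup; lookup⇒[]=; lookup∘tabulate)
open import Data.Product using (∃; _×_; _,_; proj₂)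
open import Data.Sum using (_⊎_; inj₁; inj₂)
open import Function using (_∘_; mk↔ₛ′)
open import Relation.Binary.PropositionalEquality
  using (_≡_; refl; sym; trans; cong; cong₂; subst; module ≡-Reasoning)
open import Relation.Nullary using (yes; no; does; contradiction)
open import Algebra.Properties.Semiring.Sum ℕ.+-*-semiring
  using (sum; sum-syntax; sum-cong-≗; sum-replicate-zero; sum-permute; ∑-distrib-+)

-- Sums over finite sets and cardinalities.

χ : Bool → ℕ
χ true  = 1
χ false = 0

card : ∀ {n} → (Fin n → Bool) → ℕ
card D = sum (χ ∘ D)

sum-mono-≤ : ∀ {n} {s t : Fin n → ℕ} → (∀ i → s i ≤ t i) → sum s ≤ sum t
sum-mono-≤ {zero}  s≤t = z≤n
sum-mono-≤ {suc n} s≤t = ℕ.+-mono-≤ (s≤t zero) (sum-mono-≤ (s≤t ∘ suc))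

sum-const : ∀ n c → ∑[ i < n ] c ≡ n * c
sum-const zero    c = refl
sum-const (suc n) c = cong (c +_) (sum-const n c)

sum-++ : ∀ m {n} (t : Fin (m + n) → ℕ) →
         sum t ≡ ∑[ i < m ] t (i ↑ˡ n) + ∑[ j < n ] t (m ↑ʳ j)
sum-++ zero    t = refl
sum-++ (suc m) t = trans (cong (t zero +_) (sum-++ m (t ∘ suc)))
                         (sym (ℕ.+-assoc (t zero) _ _))

sum-combine : ∀ n m (t : Fin (n * m) → ℕ) →
              sum t ≡ ∑[ i < n ] ∑[ j < m ] t (combine i j)
sum-combine zero    m t = refl
sum-combine (suc n) m t = trans (sum-++ m t)
  (cong (∑[ j < m ] t (j ↑ˡ n * m) +_) (sum-combine n m (t ∘ (m ↑ʳ_))))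

∣∣≡card : ∀ {n} (S : Subset n) → ∣ S ∣ ≡ card (lookup S)
∣∣≡card []          = refl
∣∣≡card (true  ∷ S) = cong suc (∣∣≡card S)
∣∣≡card (false ∷ S) = ∣∣≡card S

card-singleton : ∀ {n} (a : Fin n) x → card (λ h → does (h Fin.≟ a) ∧ x) ≡ χ x
card-singleton {suc n} zero    x = trans (cong (χ x +_) (sum-replicate-zero n)) (ℕ.+-identityʳ _)
card-singleton {suc n} (suc a) x = card-singleton a x

-- Successor and predecessor on the cycle.

rotation : ∀ n → Permutation′ n
rotation zero    = Perm.id
rotation (suc n) = mk↔ₛ′ next prev next∘prev prev∘next
  where
  next : Fin (suc n) → Fin (suc n)
  next i with view i
  ... | ‵fromℕ     = zero
  ... | ‵inject₁ j = suc j

  prev : Fin (suc n) → Fin (suc n)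
  prev zero    = fromℕ n
  prev (suc i) = inject₁ i

  next∘prev : ∀ i → next (prev i) ≡ i
  next∘prev zero    rewrite view-fromℕ n   = refl
  next∘prev (suc i) rewrite view-inject₁ i = refl

  prev∘next : ∀ i → prev (next i) ≡ i
  prev∘next i with view i
  ... | ‵fromℕ     = refl
  ... | ‵inject₁ j = refl

-- Both directions come from one permutation, so that `sum-permute` reindexes sums along either of
-- them.
before after : ∀ {n} → Fin n → Fin n
before i = rotation _ ⟨$⟩ˡ i
after  i = rotation _ ⟨$⟩ʳ i

before-next : ∀ {n} (j : Fin n) → Next (before j) j
before-next {suc n} zero    = wrap (cong suc (Fin.toℕ-fromℕ n)) refl
before-next {suc n} (suc i) = step (cong suc (Fin.toℕ-inject₁ i))

after-next : ∀ {n} (i : Fin n) → Next i (after i)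
after-next i = subst (λ j → Next j (after i)) (inverseˡ (rotation _)) (before-next (after i))

next⇒before : ∀ {n} {i j : Fin n} → Next i j → i ≡ before j
next⇒before {suc n} {i} {suc j} (step e)    =
  Fin.toℕ-injective (trans (ℕ.suc-injective e) (sym (Fin.toℕ-inject₁ j)))
next⇒before {suc n} {i} {zero}  (wrap e e₀) =
  Fin.toℕ-injective (trans (ℕ.suc-injective e) (sym (Fin.toℕ-fromℕ n)))

next⇒after : ∀ {n} {i j : Fin n} → Next i j → j ≡ after i
next⇒after i→j = sym (trans (cong after (next⇒before i→j)) (inverseʳ (rotation _)))

sum-before : ∀ {n} (t : Fin n → ℕ) → sum (t ∘ before) ≡ sum t
sum-before t = sym (sum-permute t (flip (rotation _)))

sum-after : ∀ {n} (t : Fin n → ℕ) → sum (t ∘ after) ≡ sum t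
sum-after t = sym (sum-permute t (rotation _))

-- Domination in the product, layer by layer.

module _ {n m : ℕ} (f : Fin n → Fin m) (D : Fin n → Fin m → Bool) where

  -- `left` and `right` are the type 2 edges at layer `g`: the one towards `before g` leaves from
  -- height `f (before g)` and arrives at height `f g`. Outside help thus arrives only at the values
  -- of `f` on the two neighbouring layers.
  data Covered (g : Fin n) (h : Fin m) : Set where
    self  : D g h ≡ true → Covered g h
    pred  : D g (before h) ≡ true → Covered g h
    succ  : D g (after h) ≡ true → Covered g h
    left  : h ≡ f (before g) → D (before g) (f g) ≡ true → Covered g h
    right : h ≡ f (after g) → D (after g) (f g) ≡ true → Covered g h

  Covers : Set
  Covers = ∀ g h → Covered g h

module _ {n m : ℕ} (3≤n : 3 ≤ n) (3≤m : 3 ≤ m) where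
  private
    module Γ f = Graph (C n 3≤n ⊗[ f ] C m 3≤m)

    layers : Subset (n * m) → Fin n → Fin m → Bool
    layers S g h = lookup S (combine g h)

  dominating⇒covers : ∀ f S → Γ.Dominating f S → Covers f (layers S)
  dominating⇒covers f S dom g h with dom (g , h)
  ... | inj₁ gh∈S                              = self ([]=⇒lookup gh∈S)
  ... | inj₂ (_ , u∈S , type₁ _ (inj₁ u→h))
      rewrite next⇒before u→h                  = pred ([]=⇒lookup u∈S)
  ... | inj₂ (_ , u∈S , type₁ _ (inj₂ h→u))
      rewrite next⇒after h→u                   = succ ([]=⇒lookup u∈S)
  ... | inj₂ (_ , u∈S , type₂ (inj₁ u→g))
      rewrite next⇒before u→g                  = left refl ([]=⇒lookup u∈S)
  ... | inj₂ (_ , u∈S , type₂ (inj₂ g→u))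
      rewrite next⇒after g→u                   = right refl ([]=⇒lookup u∈S)

  γₛ-lower : ∀ {c} → (∀ f D → Covers f D → c ≤ ∑[ g < n ] card (D g)) →
             c ≤ γₛ (C n 3≤n) (C m 3≤m)
  γₛ-lower bound =
    let (f , γ≡γₛ) , _          = γₛ-isMinimum (C n 3≤n) (C m 3≤m)
        (S , dom , ∣S∣≡γ) , _   = γ-isMinimum (C n 3≤n ⊗[ f ] C m 3≤m)
    in ℕ.≤-trans (bound f (layers S) (dominating⇒covers f S dom))
         (ℕ.≤-reflexive (trans (sym (sum-combine n m (χ ∘ lookup S)))
           (trans (sym (∣∣≡card S)) (trans ∣S∣≡γ γ≡γₛ))))

  γₛ-upper : ∀ f D → Covers f D → γₛ (C n 3≤n) (C m 3≤m) ≤ ∑[ g < n ] card (D g)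
  γₛ-upper f D cov = begin
    γₛ (C n 3≤n) (C m 3≤m)                             ≤⟨ proj₂ (γₛ-isMinimum (C n 3≤n) (C m 3≤m)) _ (f , refl) ⟩
    γ (C n 3≤n ⊗[ f ] C m 3≤m)                         ≤⟨ proj₂ (γ-isMinimum (C n 3≤n ⊗[ f ] C m 3≤m)) _ (S , dom , refl) ⟩
    ∣ S ∣                                              ≡⟨ ∣∣≡card S ⟩
    card (lookup S)                                    ≡⟨ sum-combine n m (χ ∘ lookup S) ⟩
    ∑[ g < n ] ∑[ h < m ] χ (lookup S (combine g h))   ≡⟨ sum-cong-≗ (λ g → sum-cong-≗ (λ h → cong χ (lookup-S g h))) ⟩
    ∑[ g < n ] card (D g)                              ∎
    where
    open ℕ.≤-Reasoning
    D′ : Fin n × Fin m → Bool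
    D′ (g , h) = D g h

    S : Subset (n * m)
    S = tabulate (D′ ∘ remQuot m)

    lookup-S : ∀ g h → lookup S (combine g h) ≡ D g h
    lookup-S g h = trans (lookup∘tabulate (D′ ∘ remQuot m) (combine g h))
                         (cong D′ (Fin.remQuot-combine g h))

    mem : ∀ {g h} → D g h ≡ true → Graph._∈ᵛ_ (C n 3≤n ⊗[ f ] C m 3≤m) (g , h) S
    mem {g} {h} e = lookup⇒[]= (combine g h) S (trans (lookup-S g h) e)

    dom : Γ.Dominating f S
    dom (g , h) with cov g h
    ... | self e       = inj₁ (mem e)
    ... | pred e       = inj₂ (_ , mem e , type₁ g (inj₁ (before-next h)))
    ... | succ e       = inj₂ (_ , mem e , type₁ g (inj₂ (after-next h)))
    ... | left refl e  = inj₂ (_ , mem e , type₂ (inj₁ (before-next g)))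
    ... | right refl e = inj₂ (_ , mem e , type₂ (inj₂ (after-next g)))

-- Lower bounds

-- Double counting: a vertex of `D` pays for itself and its two neighbours, an outside helper for
-- the single vertex `a` or `b`. The booleans tell whether a helper is charged, which lets
-- `pair-bound` charge a shared edge at most once.
n≤3card : ∀ {m} (D : Fin m → Bool) a b x y →
  (∀ h → D h ≡ true ⊎ D (before h) ≡ true ⊎ D (after h) ≡ true ⊎
         (h ≡ a × x ≡ true) ⊎ (h ≡ b × y ≡ true)) →
  m ≤ 3 * card D + (χ x + χ y)
n≤3card {m} D a b x y cov = begin
  m                     ≡⟨ trans (sym (ℕ.*-identityʳ m)) (sym (sum-const m 1)) ⟩
  ∑[ h < m ] 1          ≤⟨ sum-mono-≤ 1≤weight ⟩
  ∑[ h < m ] (χ (D h) + (χ (D (before h)) + (χ (D (after h)) + (χ (at a x h) + χ (at b y h)))))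
    ≡⟨ trans (∑-distrib-+ (χ ∘ D) _) (cong (card D +_)
        (trans (∑-distrib-+ (χ ∘ D ∘ before) _) (cong₂ _+_ (sum-before (χ ∘ D))
          (trans (∑-distrib-+ (χ ∘ D ∘ after) _) (cong₂ _+_ (sum-after (χ ∘ D))
            (trans (∑-distrib-+ (χ ∘ at a x) _)
              (cong₂ _+_ (card-singleton a x) (card-singleton b y)))))))) ⟩
  card D + (card D + (card D + (χ x + χ y)))
    ≡⟨ assemble (card D) (χ x + χ y) ⟩
  3 * card D + (χ x + χ y) ∎
  where
  open ℕ.≤-Reasoning
  at : Fin m → Bool → Fin m → Bool
  at c z h = does (h Fin.≟ c) ∧ z

  assemble : ∀ d r → d + (d + (d + r)) ≡ 3 * d + r
  assemble = solve-∀

  at-refl : ∀ c → χ (at c true c) ≡ 1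
  at-refl c with c Fin.≟ c
  ... | yes _   = refl
  ... | no  c≢c = contradiction refl c≢c

  1≤weight : ∀ h → 1 ≤ χ (D h) + (χ (D (before h)) + (χ (D (after h)) + (χ (at a x h) + χ (at b y h))))
  1≤weight h with cov h
  ... | inj₁ e rewrite e = s≤s z≤n
  ... | inj₂ (inj₁ e) rewrite e = ℕ.m≤n⇒m≤o+n (χ (D h)) (s≤s z≤n)
  ... | inj₂ (inj₂ (inj₁ e)) rewrite e =
    ℕ.m≤n⇒m≤o+n (χ (D h)) (ℕ.m≤n⇒m≤o+n (χ (D (before h))) (s≤s z≤n))
  ... | inj₂ (inj₂ (inj₂ (inj₁ (refl , refl)))) rewrite at-refl h =
    ℕ.m≤n⇒m≤o+n (χ (D h)) (ℕ.m≤n⇒m≤o+n (χ (D (before h)))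
      (ℕ.m≤n⇒m≤o+n (χ (D (after h))) (s≤s z≤n)))
  ... | inj₂ (inj₂ (inj₂ (inj₂ (refl , refl)))) rewrite at-refl h =
    ℕ.m≤n⇒m≤o+n (χ (D h)) (ℕ.m≤n⇒m≤o+n (χ (D (before h)))
      (ℕ.m≤n⇒m≤o+n (χ (D (after h))) (ℕ.m≤n+m 1 (χ (at a x h)))))

module _ {n m : ℕ} {f : Fin n → Fin m} {D : Fin n → Fin m → Bool} (cov : Covers f D) where

  layer-bound : ∀ g → m ≤ 3 * card (D g) + 2
  layer-bound g = n≤3card (D g) (f (before g)) (f (after g)) true true λ h → split (cov g h)
    where
    split : ∀ {h} → Covered f D g h → _
    split (self e)    = inj₁ e
    split (pred e)    = inj₂ (inj₁ e)
    split (succ e)    = inj₂ (inj₂ (inj₁ e))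
    split (left e _)  = inj₂ (inj₂ (inj₂ (inj₁ (e , refl))))
    split (right e _) = inj₂ (inj₂ (inj₂ (inj₂ (e , refl))))

  -- An end of the edge between layers g and g + 1 needs that edge only if it is
  -- not itself in D while the other end is; so at most one of the two ends does.
  pair-bound : ∀ g → 2 * m ≤ 3 * (card (D g) + card (D (after g))) + 3
  pair-bound g = begin
    2 * m                                                  ≡⟨ cong (m +_) (ℕ.+-identityʳ m) ⟩
    m + m                                                  ≤⟨ ℕ.+-mono-≤ bound bound′ ⟩
    -- In each bracket the 1 pays for the edge leaving the pair, the `χ` term for the shared edge.
    (3 * card (D g) + (1 + χ (y ∧ not x))) +
      (3 * card (D g′) + (χ (x ∧ not y) + 1))              ≡⟨ regroup (card (D g)) (card (D g′)) (χ (y ∧ not x)) (χ (x ∧ not y)) ⟩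
    3 * (card (D g) + card (D g′)) +
      (2 + (χ (y ∧ not x) + χ (x ∧ not y)))                ≤⟨ ℕ.+-monoʳ-≤ (3 * (card (D g) + card (D g′))) (ℕ.+-monoʳ-≤ 2 (exclusive x y)) ⟩
    3 * (card (D g) + card (D g′)) + 3                     ∎
    where
    open ℕ.≤-Reasoning
    g′ = after g
    x = D g (f g′)
    y = D g′ (f g)

    regroup : ∀ d d′ u v → (3 * d + (1 + u)) + (3 * d′ + (v + 1)) ≡ 3 * (d + d′) + (2 + (u + v))
    regroup = solve-∀

    exclusive : ∀ x y → χ (y ∧ not x) + χ (x ∧ not y) ≤ 1
    exclusive true  true  = z≤n
    exclusive true  false = s≤s z≤n
    exclusive false true  = s≤s z≤n
    exclusive false false = z≤n

    unless : ∀ a {b} → b ≡ true → a ≡ true ⊎ b ∧ not a ≡ true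
    unless true  _    = inj₁ refl
    unless false refl = inj₂ refl

    bound : m ≤ 3 * card (D g) + (1 + χ (y ∧ not x))
    bound = n≤3card (D g) (f (before g)) (f g′) true (y ∧ not x) λ h → split (cov g h)
      where
      split : ∀ {h} → Covered f D g h → _
      split (self e)   = inj₁ e
      split (pred e)   = inj₂ (inj₁ e)
      split (succ e)   = inj₂ (inj₂ (inj₁ e))
      split (left e _) = inj₂ (inj₂ (inj₂ (inj₁ (e , refl))))
      split (right refl e) with unless x e
      ... | inj₁ x≡true = inj₁ x≡true
      ... | inj₂ w      = inj₂ (inj₂ (inj₂ (inj₂ (refl , w))))

    bound′ : m ≤ 3 * card (D g′) + (χ (x ∧ not y) + 1)
    bound′ = n≤3card (D g′) (f g) (f (after g′)) (x ∧ not y) true λ h → split (cov g′ h)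
      where
      split : ∀ {h} → Covered f D g′ h → _
      split (self e)    = inj₁ e
      split (pred e)    = inj₂ (inj₁ e)
      split (succ e)    = inj₂ (inj₂ (inj₁ e))
      split (right e _) = inj₂ (inj₂ (inj₂ (inj₂ (e , refl))))
      -- Rewriting `before (after g)` to `g` identifies the left edge of `g′` with the shared edge.
      split (left refl e) rewrite inverseˡ (rotation n) {g} with unless y e
      ... | inj₁ y≡true = inj₁ y≡true
      ... | inj₂ w      = inj₂ (inj₂ (inj₂ (inj₁ (refl , w))))

k*n≤size : ∀ {n k} p {f : Fin n → Fin (3 * k + p)} {D} → Covers f D → k * n ≤ ∑[ g < n ] card (D g)
k*n≤size {n} {k} p {D = D} cov = begin
  k * n                   ≡⟨ ℕ.*-comm k n ⟩
  n * k                   ≡⟨ sum-const n k ⟨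
  ∑[ g < n ] k            ≤⟨ sum-mono-≤ large ⟩
  ∑[ g < n ] card (D g)   ∎
  where
  open ℕ.≤-Reasoning
  large : ∀ g → k ≤ card (D g)
  -- Two helpers are fewer than the three vertices one more element would cover: 3k ≤ 3c + 2 < 3(c +
  -- 1) forces k ≤ c.
  large g = ℕ.≤-pred (ℕ.*-cancelˡ-< 3 k (suc (card (D g))) (begin-strict
    3 * k                  ≤⟨ ℕ.m≤m+n (3 * k) p ⟩
    3 * k + p              ≤⟨ layer-bound cov g ⟩
    3 * card (D g) + 2     <⟨ ℕ.+-monoʳ-< (3 * card (D g)) (ℕ.n<1+n 2) ⟩
    3 * card (D g) + 3     ≡⟨ trans (ℕ.+-comm _ 3) (sym (ℕ.*-suc 3 (card (D g)))) ⟩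
    3 * suc (card (D g))   ∎))

-- Summed around the cycle, the bound 2k + 1 for consecutive layers counts every layer twice. Hence
-- twice the size is at least n(2k + 1), where n ≥ 2⌊n/2⌋.
k*n+⌊n/2⌋≤size : ∀ {n k} {f : Fin n → Fin (3 * k + 2)} {D} → Covers f D →
         k * n + ⌊ n /2⌋ ≤ ∑[ g < n ] card (D g)
k*n+⌊n/2⌋≤size {n} {k} {D = D} cov = ℕ.*-cancelˡ-≤ 2 (begin
  2 * (k * n + ⌊ n /2⌋)                          ≡⟨ expand k n ⌊ n /2⌋ ⟩
  n * (2 * k) + (⌊ n /2⌋ + ⌊ n /2⌋)              ≤⟨ ℕ.+-monoʳ-≤ (n * (2 * k)) (ℕ.+-monoʳ-≤ ⌊ n /2⌋ (ℕ.⌊n/2⌋≤⌈n/2⌉ n)) ⟩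
  n * (2 * k) + (⌊ n /2⌋ + ⌈ n /2⌉)              ≡⟨ cong (n * (2 * k) +_) (ℕ.⌊n/2⌋+⌈n/2⌉≡n n) ⟩
  n * (2 * k) + n                                ≡⟨ trans (ℕ.+-comm _ n) (sym (ℕ.*-suc n (2 * k))) ⟩
  n * suc (2 * k)                                ≡⟨ sum-const n (suc (2 * k)) ⟨
  ∑[ g < n ] suc (2 * k)                         ≤⟨ sum-mono-≤ large ⟩
  ∑[ g < n ] (card (D g) + card (D (after g)))   ≡⟨ ∑-distrib-+ (card ∘ D) (card ∘ D ∘ after) ⟩
  sum (card ∘ D) + sum (card ∘ D ∘ after)        ≡⟨ cong (sum (card ∘ D) +_) (trans (sum-after (card ∘ D)) (sym (ℕ.+-identityʳ _))) ⟩
  2 * ∑[ g < n ] card (D g)                      ∎)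
  where
  open ℕ.≤-Reasoning
  expand : ∀ k n h → 2 * (k * n + h) ≡ n * (2 * k) + (h + h)
  expand = solve-∀

  -- The final 3 cancels against that of `pair-bound`; the `suc` makes the remaining inequality
  -- strict, so that dividing by 3 yields 2k + 1.
  regroup : ∀ k → 2 * (3 * k + 2) ≡ suc (3 * (2 * k)) + 3
  regroup = solve-∀

  large : ∀ g → 2 * k < card (D g) + card (D (after g))
  large g = ℕ.*-cancelˡ-< 3 (2 * k) _ (ℕ.+-cancelʳ-≤ 3 _ _
    (subst (_≤ 3 * (card (D g) + card (D (after g))) + 3) (regroup k) (pair-bound cov g)))

-- Upper bounds

-- The multiples of 3; recursion in steps of three makes periodicity hold by `refl`.
every3 : ℕ → Bool
every3 0                   = true
every3 1                   = false
every3 2                   = false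
every3 (suc (suc (suc j))) = every3 j

-- By periodicity the value at 2 + j is that at the predecessor of j, so for the set `full` the
-- alternatives mean: j itself, its successor, its predecessor.
every3-within : ∀ j → every3 j ≡ true ⊎ every3 (1 + j) ≡ true ⊎ every3 (2 + j) ≡ true
every3-within 0                   = inj₁ refl
every3-within 1                   = inj₂ (inj₂ refl)
every3-within 2                   = inj₂ (inj₁ refl)
every3-within (suc (suc (suc j))) = every3-within j

3*suc : ∀ k p → 3 * suc k + p ≡ 3 + (3 * k + p)
3*suc = solve-∀

every3-3* : ∀ k p → every3 (3 * k + p) ≡ every3 p
every3-3* zero    p = refl
every3-3* (suc k) p = trans (cong every3 (3*suc k p)) (every3-3* k p)

-- As vertex sets of C_m: if m ≢ 0 (mod 3), headless fails to dominate 1 and, if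
-- m ≡ 2, also 0; for m = 3k + 1, shifted fails to dominate 3k only.
data Kind : Set where
  full headless shifted : Kind

⟦_⟧ : Kind → ℕ → Bool
⟦ full     ⟧ j       = every3 j
⟦ headless ⟧ zero    = false
⟦ headless ⟧ (suc j) = every3 (suc j)
⟦ shifted  ⟧ j       = every3 (2 + j)

card-periodic : ∀ (P : ℕ → Bool) → (∀ j → P (3 + j) ≡ P j) →
  χ (P 0) + (χ (P 1) + χ (P 2)) ≡ 1 →
  ∀ k p → card (P ∘ toℕ {3 * k + p}) ≡ k + card (P ∘ toℕ {p})
card-periodic P per one zero    p = refl
card-periodic P per one (suc k) p = begin
  card (P ∘ toℕ {3 * suc k + p})
    ≡⟨ cong (λ m → card (P ∘ toℕ {m})) (3*suc k p) ⟩
  χ (P 0) + (χ (P 1) + (χ (P 2) + ∑[ j < 3 * k + p ] χ (P (3 + toℕ j))))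
    ≡⟨ cong (λ z → χ (P 0) + (χ (P 1) + (χ (P 2) + z))) (sum-cong-≗ (λ j → cong χ (per (toℕ {3 * k + p} j)))) ⟩
  χ (P 0) + (χ (P 1) + (χ (P 2) + card (P ∘ toℕ {3 * k + p})))
    ≡⟨ regroup (χ (P 0)) (χ (P 1)) (χ (P 2)) _ ⟩
  χ (P 0) + (χ (P 1) + χ (P 2)) + card (P ∘ toℕ {3 * k + p})
    ≡⟨ cong₂ _+_ one (card-periodic P per one k p) ⟩
  suc (k + card (P ∘ toℕ {p})) ∎
  where
  open ≡-Reasoning
  regroup : ∀ a b c d → a + (b + (c + d)) ≡ a + (b + c) + d
  regroup = solve-∀

card-full : ∀ k p → card (⟦ full ⟧ ∘ toℕ {3 * k + p}) ≡ k + card (⟦ full ⟧ ∘ toℕ {p})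
card-full = card-periodic every3 (λ _ → refl) refl

card-shifted : ∀ k → card (⟦ shifted ⟧ ∘ toℕ {3 * k + 1}) ≡ k
card-shifted k = trans (card-periodic ⟦ shifted ⟧ (λ _ → refl) refl k 1) (ℕ.+-identityʳ k)

card-full≡1+headless : ∀ {m} → 0 < m → card (⟦ full ⟧ ∘ toℕ {m}) ≡ suc (card (⟦ headless ⟧ ∘ toℕ {m}))
card-full≡1+headless (s≤s _) = refl

-- Domination inside the cycle, on natural numbers so that membership computes. The proviso of
-- `succ` handles the wrap from m - 1 to 0, and `pred₀` the wrap in the other direction.
data CycleCovered (P : ℕ → Bool) (m j : ℕ) : Set where
  self  : P j ≡ true → CycleCovered P m j
  pred  : ∀ {i} → j ≡ suc i → P i ≡ true → CycleCovered P m j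
  pred₀ : ∀ {i} → j ≡ 0 → m ≡ suc i → P i ≡ true → CycleCovered P m j
  succ  : P (suc j) ≡ true → (suc j ≡ m → P 0 ≡ true) → CycleCovered P m j

-- The set contains 0, so a last vertex relying on its successor is covered across the wrap,
-- whatever m is modulo 3.
full-covers : ∀ m j → CycleCovered ⟦ full ⟧ m j
full-covers m j with every3-within j
... | inj₁ e        = self e
... | inj₂ (inj₁ e) = succ e (λ _ → refl)
full-covers m (suc j) | inj₂ (inj₂ e) = pred refl e

-- From 2 on no predecessor is the removed 0, and the last vertex relies on its successor only if 3
-- divides m.
headless-covers : ∀ m → every3 m ≡ false → ∀ j → CycleCovered ⟦ headless ⟧ m (2 + j)
headless-covers m e₀ j with every3-within (2 + j)
... | inj₁ e        = self e
... | inj₂ (inj₁ e) = succ e λ { refl → contradiction (trans (sym e) e₀) λ () }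
... | inj₂ (inj₂ e) = pred refl e

-- Vertex 0 is covered across the wrap by 3k, a multiple of 3 that is not the removed 0 because k ≥
-- 1.
headless-covers-0 : ∀ k → 1 ≤ k → CycleCovered ⟦ headless ⟧ (3 * k + 1) 0
headless-covers-0 (suc k) _ = pred₀ refl (shape k) (every3-3* k 0)
  where
  shape : ∀ k → 3 * suc k + 1 ≡ 4 + (3 * k + 0)
  shape = solve-∀

-- The set is 1, 4, 7, and so on. Multiples of 3 rely on their successor, which is lost only at the
-- wrap, that is at 3k.
shifted-covers : ∀ k j → j ≡ 3 * k ⊎ CycleCovered ⟦ shifted ⟧ (3 * k + 1) j
shifted-covers k j with every3-within j
... | inj₂ (inj₂ e) = inj₂ (self e)
shifted-covers k (suc j) | inj₂ (inj₁ e) = inj₂ (pred refl e)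
shifted-covers k j       | inj₁ e with j ℕ.≟ 3 * k
... | yes j≡3k = inj₁ j≡3k
... | no  j≢3k = inj₂ (succ e λ 1+j≡m →
  contradiction (ℕ.suc-injective (trans 1+j≡m (ℕ.+-comm (3 * k) 1))) j≢3k)

module _ {n m} {f : Fin n → Fin m} {P : Fin n → ℕ → Bool} where

  cycle-covered : ∀ {g h} → CycleCovered (P g) m (toℕ h) → Covered f (λ g → P g ∘ toℕ) g h
  cycle-covered (self e) = self e
  cycle-covered {g} {h} (pred j≡1+i e) with before-next h
  ... | step e′    = pred (subst (λ i → P g i ≡ true) (sym (ℕ.suc-injective (trans e′ j≡1+i))) e)
  ... | wrap _ e₀  = contradiction (trans (sym e₀) j≡1+i) λ ()
  cycle-covered {g} {h} (pred₀ j≡0 m≡1+i e) with before-next h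
  ... | step e′    = contradiction (trans e′ j≡0) λ ()
  ... | wrap e′ _  = pred (subst (λ i → P g i ≡ true) (sym (ℕ.suc-injective (trans e′ m≡1+i))) e)
  cycle-covered {g} {h} (succ e e₀) with after-next h
  ... | step e′    = succ (trans (cong (P g) (sym e′)) e)
  ... | wrap e′ e″ = succ (trans (cong (P g) e″) (e₀ e′))

-- Layers repeating with period 4.

data Phase : Set where
  q₀ q₁ q₂ q₃ : Phase

next : Phase → Phase
next q₀ = q₁
next q₁ = q₂
next q₂ = q₃
next q₃ = q₀

phase : Phase → ℕ → Phase
phase s zero    = s
phase s (suc i) = phase (next s) i

phase-suc : ∀ s i → phase s (suc i) ≡ next (phase s i)
phase-suc s zero    = refl
phase-suc s (suc i) = phase-suc (next s) i

phase-q₀-%4 : ∀ n → n % 4 ≡ 0 → phase q₀ n ≡ q₀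
phase-q₀-%4 0                         _ = refl
-- `%` computes through four successors, so `e` also speaks of the smaller number.
phase-q₀-%4 (suc (suc (suc (suc n)))) e = phase-q₀-%4 n e

-- The flag tells whether layer 0 is the exceptional one.
kind : (Phase → Kind) → Phase → Bool → ℕ → Kind
kind L s true  zero    = full
kind L s true  (suc i) = L (phase s (suc i))
kind L s false i       = L (phase s i)

-- The phase equation is kept because an exceptional layer must still help its successor, and which
-- vertex that takes depends on the phase.
kind-full⊎L : ∀ L s b i → (kind L s b i ≡ full × phase s i ≡ s) ⊎ kind L s b i ≡ L (phase s i)
kind-full⊎L L s true  zero    = inj₁ (refl , refl)
kind-full⊎L L s true  (suc i) = inj₂ refl
kind-full⊎L L s false i       = inj₂ refl

extra : Bool → ℕ → ℕ
extra b zero    = χ b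
extra b (suc _) = 0

sum-extra : ∀ n b → ∑[ i < n ] extra b (toℕ i) ≤ χ b
sum-extra zero    b = z≤n
sum-extra (suc n) b = ℕ.≤-reflexive (trans (cong (χ b +_) (sum-replicate-zero n)) (ℕ.+-identityʳ _))

module Periodic (n : ℕ) (L : Phase → Kind) (s : Phase) (b : Bool) where

  q : Fin n → Phase
  q g = phase s (toℕ g)

  K : Fin n → Kind
  K g = kind L s b (toℕ g)

  K-full⊎L : ∀ g → (K g ≡ full × q g ≡ s) ⊎ K g ≡ L (q g)
  K-full⊎L g = kind-full⊎L L s b (toℕ g)

  q-step : ∀ {g g′} → suc (toℕ g) ≡ toℕ g′ → q g′ ≡ next (q g)
  q-step {g} e = trans (cong (phase s) (sym e)) (phase-suc s (toℕ g))

  q-last : ∀ {g} → suc (toℕ g) ≡ n → phase s n ≡ next (q g)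
  q-last {g} e = trans (cong (phase s) (sym e)) (phase-suc s (toℕ g))

  -- Only the wrap from the last layer to layer 0 is in doubt: there either layer 0 is the
  -- exceptional `full` one, or the phases close up.
  K-next : b ≡ true ⊎ phase s n ≡ s → ∀ {g g′} → Next g g′ →
           K g′ ≡ full ⊎ (q g′ ≡ next (q g) × K g′ ≡ L (q g′))
  K-next _ {g} {g′} (step e) with K-full⊎L g′
  ... | inj₁ (K≡full , _) = inj₁ K≡full
  ... | inj₂ K≡L          = inj₂ (q-step e , K≡L)
  K-next (inj₁ b≡true) (wrap e e₀) = inj₁ (cong₂ (kind L s) b≡true e₀)
  K-next (inj₂ closed) {g} {g′} (wrap e e₀) with K-full⊎L g′
  ... | inj₁ (K≡full , _) = inj₁ K≡full
  ... | inj₂ K≡L          =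
    inj₂ (trans (cong (phase s) e₀) (trans (sym closed) (q-last e)) , K≡L)

  module _ {m k : ℕ} (w : Phase → ℕ)
           (card-full≤ : card (⟦ full ⟧ ∘ toℕ {m}) ≤ k + 1)
           (card-L≤ : ∀ r → card (⟦ L r ⟧ ∘ toℕ {m}) ≤ k + w r) where

    card-kind≤ : ∀ b i → card (⟦ kind L s b i ⟧ ∘ toℕ {m}) ≤ k + (w (phase s i) + extra b i)
    card-kind≤ true  zero    =
      ℕ.≤-trans card-full≤ (ℕ.+-monoʳ-≤ k (ℕ.m≤n+m 1 (w s)))
    card-kind≤ true  (suc i) =
      ℕ.≤-trans (card-L≤ _) (ℕ.+-monoʳ-≤ k (ℕ.m≤m+n _ 0))
    card-kind≤ false i       =
      ℕ.≤-trans (card-L≤ _) (ℕ.+-monoʳ-≤ k (ℕ.m≤m+n _ (extra false i)))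

    sum-card≤ : ∑[ g < n ] card (⟦ K g ⟧ ∘ toℕ {m}) ≤ k * n + ∑[ g < n ] w (q g) + χ b
    sum-card≤ = begin
      ∑[ g < n ] card (⟦ K g ⟧ ∘ toℕ {m})                  ≤⟨ sum-mono-≤ {n} (λ g → card-kind≤ b (toℕ g)) ⟩
      ∑[ g < n ] (k + (w (q g) + extra b (toℕ g)))         ≡⟨ ∑-distrib-+ {n} (λ _ → k) _ ⟩
      ∑[ g < n ] k + ∑[ g < n ] (w (q g) + extra b (toℕ g)) ≡⟨ cong₂ _+_ (trans (sum-const n k) (ℕ.*-comm n k)) (∑-distrib-+ {n} (w ∘ q) _) ⟩
      k * n + (∑[ g < n ] w (q g) + ∑[ g < n ] extra b (toℕ g)) ≡⟨ ℕ.+-assoc (k * n) _ _ ⟨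
      k * n + ∑[ g < n ] w (q g) + ∑[ g < n ] extra b (toℕ g) ≤⟨ ℕ.+-monoʳ-≤ (k * n + ∑[ g < n ] w (q g)) (sum-extra n b) ⟩
      k * n + ∑[ g < n ] w (q g) + χ b                     ∎
      where open ℕ.≤-Reasoning

-- Upper bound for p = 0.

upper₀ : ∀ {n k} (3≤n : 3 ≤ n) (1≤k : 1 ≤ k) →
         γₛ (C n 3≤n) (C (3 * k + 0) (3≤3k+ 0 1≤k)) ≤ k * n
upper₀ {n} {k} 3≤n 1≤k = ℕ.≤-trans
  -- The multiples of 3 dominate each layer from within, so a constant `f` will do.
  (γₛ-upper 3≤n (3≤3k+ 0 1≤k) (λ _ → Graph.vertex (C (3 * k + 0) (3≤3k+ 0 1≤k)))
    (λ _ → ⟦ full ⟧ ∘ toℕ) λ g h → cycle-covered (full-covers _ (toℕ h)))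
  (ℕ.≤-reflexive (trans (sum-cong-≗ {n} (λ _ → trans (card-full k 0) (ℕ.+-identityʳ k)))
    (trans (sum-const n k) (ℕ.*-comm n k))))

-- Upper bound for p = 1.

module RemainderOne {n k : ℕ} (1≤k : 1 ≤ k) (b : Bool) (closed : b ≡ true ⊎ phase q₀ n ≡ q₀) where

  m : ℕ
  m = 3 * k + 1

  0<m : 0 < m
  0<m = ℕ.m≤n+m 1 (3 * k)

  u v : Fin m
  u = Fin.fromℕ< {1} (ℕ.≤-trans (s≤s (s≤s z≤n)) (3≤3k+ 1 1≤k))
  v = Fin.fromℕ< {3 * k} (ℕ.m<m+n (3 * k) (s≤s z≤n))

  -- The value of `f` at phase r must be the vertex that `L (next r)` fails to dominate, and
  -- `V (next r)` must belong to `L r`. As `headless` misses `u` and contains `v`, while `shifted`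
  -- does the opposite, the kinds two phases apart differ, whence period 4.
  V : Phase → Fin m
  V q₀ = v
  V q₁ = v
  V q₂ = u
  V q₃ = u

  L : Phase → Kind
  L q₀ = headless
  L q₁ = shifted
  L q₂ = shifted
  L q₃ = headless

  open Periodic n L q₀ b

  f : Fin n → Fin m
  f = V ∘ q

  D : Fin n → Fin m → Bool
  D g = ⟦ K g ⟧ ∘ toℕ

  v∈full : ⟦ full ⟧ (toℕ v) ≡ true
  v∈full = trans (cong every3 (trans (Fin.toℕ-fromℕ< _) (sym (ℕ.+-identityʳ (3 * k))))) (every3-3* k 0)

  v∈headless : ⟦ headless ⟧ (toℕ v) ≡ true
  v∈headless = go 1≤k (Fin.toℕ-fromℕ< _) v∈full
    where
    go : ∀ {k j} → 1 ≤ k → j ≡ 3 * k → every3 j ≡ true → ⟦ headless ⟧ j ≡ true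
    go (s≤s _) refl e = e

  u∈shifted : ⟦ shifted ⟧ (toℕ u) ≡ true
  u∈shifted = cong ⟦ shifted ⟧ {toℕ u} {1} (Fin.toℕ-fromℕ< _)

  headless-or-u : ∀ h → h ≡ u ⊎ CycleCovered ⟦ headless ⟧ m (toℕ h)
  headless-or-u h with toℕ h in e
  ... | 0           = inj₂ (headless-covers-0 k 1≤k)
  ... | 1           = inj₁ (Fin.toℕ-injective (trans e (sym (Fin.toℕ-fromℕ< _))))
  ... | suc (suc j) = inj₂ (headless-covers m (every3-3* k 1) j)

  shifted-or-v : ∀ h → h ≡ v ⊎ CycleCovered ⟦ shifted ⟧ m (toℕ h)
  shifted-or-v h with shifted-covers k (toℕ h)
  ... | inj₁ e = inj₁ (Fin.toℕ-injective (trans e (sym (Fin.toℕ-fromℕ< _))))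
  ... | inj₂ c = inj₂ c

  L-or-V : ∀ r h → h ≡ V r ⊎ CycleCovered ⟦ L (next r) ⟧ m (toℕ h)
  L-or-V q₀ = shifted-or-v
  L-or-V q₁ = shifted-or-v
  L-or-V q₂ = headless-or-u
  L-or-V q₃ = headless-or-u

  V∈L : ∀ r → ⟦ L r ⟧ (toℕ (V (next r))) ≡ true
  V∈L q₀ = v∈headless
  V∈L q₁ = u∈shifted
  V∈L q₂ = u∈shifted
  V∈L q₃ = v∈headless

  V∈K : ∀ g → ⟦ K g ⟧ (toℕ (V (next (q g)))) ≡ true
  V∈K g with K-full⊎L g
  -- The start q₀ matters: layer 1 then asks layer 0 for `v` = 3k, which `full` contains, and not
  -- for `u` = 1.
  ... | inj₁ (K≡full , q≡q₀) rewrite K≡full | q≡q₀ = v∈full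
  ... | inj₂ K≡L             rewrite K≡L           = V∈L (q g)

  covers : Covers f D
  covers g h with K-next closed (before-next g)
  ... | inj₁ K≡full = cycle-covered (subst (λ κ → CycleCovered ⟦ κ ⟧ m (toℕ h)) (sym K≡full) (full-covers m (toℕ h)))
  ... | inj₂ (q≡ , K≡L) with L-or-V (q (before g)) h
  ...   | inj₁ h≡V = left h≡V (trans (cong (⟦ K (before g) ⟧ ∘ toℕ ∘ V) q≡) (V∈K (before g)))
  ...   | inj₂ c   = cycle-covered (subst (λ κ → CycleCovered ⟦ κ ⟧ m (toℕ h)) (sym (trans K≡L (cong L q≡))) c)

  card-headless : card (⟦ headless ⟧ ∘ toℕ {m}) ≡ k
  card-headless = ℕ.suc-injective (trans (sym (card-full≡1+headless 0<m))
    (trans (card-full k 1) (ℕ.+-comm k 1)))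

  card-L : ∀ r → card (⟦ L r ⟧ ∘ toℕ {m}) ≡ k
  card-L q₀ = card-headless
  card-L q₁ = card-shifted k
  card-L q₂ = card-shifted k
  card-L q₃ = card-headless

  size : ∑[ g < n ] card (D g) ≤ k * n + χ b
  size = begin
    ∑[ g < n ] card (D g)              ≤⟨ sum-card≤ {m} {k} (λ _ → 0) (ℕ.≤-reflexive (card-full k 1))
                                            (λ r → ℕ.≤-trans (ℕ.≤-reflexive (card-L r)) (ℕ.m≤m+n k 0)) ⟩
    k * n + ∑[ g < n ] 0 + χ b         ≡⟨ cong (_+ χ b) (trans (cong (k * n +_) (sum-replicate-zero n)) (ℕ.+-identityʳ _)) ⟩
    k * n + χ b                        ∎
    where open ℕ.≤-Reasoning

  upper : (3≤n : 3 ≤ n) → γₛ (C n 3≤n) (C (3 * k + 1) (3≤3k+ 1 1≤k)) ≤ k * n + χ b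
  upper 3≤n = ℕ.≤-trans (γₛ-upper 3≤n (3≤3k+ 1 1≤k) f D covers) size

-- Upper bound for p = 2.

data Even : Phase → Set where
  even₀ : Even q₀
  even₂ : Even q₂

odd : Phase → ℕ
odd q₀ = 0
odd q₁ = 1
odd q₂ = 0
odd q₃ = 1

-- The even start makes the rounding go down; an odd one would give the ceiling.
sum-odd : ∀ n {s} → Even s → ∑[ i < n ] odd (phase s (toℕ i)) ≡ ⌊ n /2⌋
sum-odd 0             _     = refl
sum-odd 1             even₀ = refl
sum-odd 1             even₂ = refl
sum-odd (suc (suc n)) even₀ = cong suc (sum-odd n even₂)
sum-odd (suc (suc n)) even₂ = cong suc (sum-odd n even₀)

-- Whether `f` is 1 instead of 0. A headless layer misses 0 and 1, so `f` must take both values on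
-- its two full neighbours and hence alternates along the odd phases. On even phases it is 0, a
-- vertex that the full layers contain.
raised : Phase → Bool
raised q₁ = true
raised _  = false

raised-even : ∀ {s} → Even s → raised s ≡ false
raised-even even₀ = refl
raised-even even₂ = refl

-- With an exceptional layer 0 the phases need not close up, but layer n - 1
-- still has to see the value of f that its phase prescribes for its successor.
lowered-start : ∀ n → ∃ λ s → Even s × raised (phase s n) ≡ false
lowered-start n with go n
  where
  go : ∀ n → raised (phase q₀ n) ≡ false ⊎ raised (phase q₂ n) ≡ false
  go 0                         = inj₁ refl
  go 1                         = inj₂ refl
  go 2                         = inj₁ refl
  go 3                         = inj₁ refl
  go (suc (suc (suc (suc n)))) = go n
... | inj₁ e = q₀ , even₀ , e
... | inj₂ e = q₂ , even₂ , e

module RemainderTwo {n k : ℕ} (1≤k : 1 ≤ k) (b : Bool) {s : Phase} (even : Even s)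
                    (lowered : raised (phase s n) ≡ false) (closed : b ≡ true ⊎ phase s n ≡ s) where

  m : ℕ
  m = 3 * k + 2

  1<m : 1 < m
  1<m = ℕ.m≤n+m 2 (3 * k)

  pos : Bool → Fin m
  pos false = Fin.fromℕ< {0} (ℕ.<⇒≤ 1<m)
  pos true  = Fin.fromℕ< {1} 1<m

  L : Phase → Kind
  L q₀ = headless
  L q₁ = full
  L q₂ = headless
  L q₃ = full

  open Periodic n L s b

  f : Fin n → Fin m
  f = pos ∘ raised ∘ q

  D : Fin n → Fin m → Bool
  D g = ⟦ K g ⟧ ∘ toℕ

  headless-or-01 : ∀ h → h ≡ pos false ⊎ h ≡ pos true ⊎ CycleCovered ⟦ headless ⟧ m (toℕ h)
  headless-or-01 h with toℕ h in e
  ... | 0           = inj₁ (Fin.toℕ-injective (trans e (sym (Fin.toℕ-fromℕ< _))))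
  ... | 1           = inj₂ (inj₁ (Fin.toℕ-injective (trans e (sym (Fin.toℕ-fromℕ< _)))))
  ... | suc (suc j) = inj₂ (inj₂ (headless-covers m (every3-3* k 2) j))

  0∈full : ∀ {κ x} → κ ≡ full → x ≡ false → ⟦ κ ⟧ (toℕ (pos x)) ≡ true
  0∈full refl refl = cong every3 {toℕ (pos false)} {0} (Fin.toℕ-fromℕ< _)

  full-covered : ∀ {g} h → K g ≡ full → Covered f D g h
  full-covered h K≡full =
    cycle-covered (subst (λ κ → CycleCovered ⟦ κ ⟧ m (toℕ h)) (sym K≡full) (full-covers m (toℕ h)))

  -- At the wrap the phases may disagree, but neither is raised: the actual one because it is even,
  -- the prescribed one by `lowered`.
  raised-next : ∀ {g g′} → Next g g′ → raised (q g′) ≡ raised (next (q g))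
  raised-next (step e)    = cong raised (q-step e)
  raised-next (wrap e e₀) = trans (cong (raised ∘ phase s) e₀)
    (trans (raised-even even) (trans (sym lowered) (cong raised (q-last e))))

  K-before : ∀ g → L (q (before g)) ≡ full → K (before g) ≡ full
  K-before g L≡full with K-full⊎L (before g)
  ... | inj₁ (K≡full , _) = K≡full
  ... | inj₂ K≡L          = trans K≡L L≡full

  K-after : ∀ g → L (next (q g)) ≡ full → K (after g) ≡ full
  K-after g L≡full with K-next closed (after-next g)
  ... | inj₁ K≡full     = K≡full
  ... | inj₂ (q≡ , K≡L) = trans K≡L (trans (cong L q≡) L≡full)

  covered : ∀ g h r → q (before g) ≡ r → q g ≡ next r → K g ≡ L (q g) → Covered f D g h
  covered g h q₀ _ qg K≡L = full-covered h (trans K≡L (cong L qg))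
  covered g h q₂ _ qg K≡L = full-covered h (trans K≡L (cong L qg))
  -- At phase q₂ the preceding layer has `f` = 1 and helps at 1, the following one helps at 0; at
  -- phase q₀ the sides are exchanged.
  covered g h q₁ qb qg K≡L with headless-or-01 h
  ... | inj₁ refl        =
    right (cong pos (sym (trans (raised-next (after-next g)) (cong (raised ∘ next) qg))))
          (0∈full (K-after g (cong (L ∘ next) qg)) (cong raised qg))
  ... | inj₂ (inj₁ refl) =
    left (cong (pos ∘ raised) (sym qb)) (0∈full (K-before g (cong L qb)) (cong raised qg))
  ... | inj₂ (inj₂ c)    =
    cycle-covered (subst (λ κ → CycleCovered ⟦ κ ⟧ m (toℕ h)) (sym (trans K≡L (cong L qg))) c)
  covered g h q₃ qb qg K≡L with headless-or-01 h
  ... | inj₁ refl        =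
    left (cong (pos ∘ raised) (sym qb)) (0∈full (K-before g (cong L qb)) (cong raised qg))
  ... | inj₂ (inj₁ refl) =
    right (cong pos (sym (trans (raised-next (after-next g)) (cong (raised ∘ next) qg))))
          (0∈full (K-after g (cong (L ∘ next) qg)) (cong raised qg))
  ... | inj₂ (inj₂ c)    =
    cycle-covered (subst (λ κ → CycleCovered ⟦ κ ⟧ m (toℕ h)) (sym (trans K≡L (cong L qg))) c)

  covers : Covers f D
  covers g h with K-next closed (before-next g)
  ... | inj₁ K≡full     = full-covered h K≡full
  ... | inj₂ (q≡ , K≡L) = covered g h (q (before g)) refl q≡ K≡L

  card-headless : card (⟦ headless ⟧ ∘ toℕ {m}) ≡ k
  card-headless = ℕ.suc-injective (trans (sym (card-full≡1+headless (ℕ.<⇒≤ 1<m)))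
    (trans (card-full k 2) (ℕ.+-comm k 1)))

  card-L : ∀ r → card (⟦ L r ⟧ ∘ toℕ {m}) ≡ k + odd r
  card-L q₀ = trans card-headless (sym (ℕ.+-identityʳ k))
  card-L q₁ = card-full k 2
  card-L q₂ = trans card-headless (sym (ℕ.+-identityʳ k))
  card-L q₃ = card-full k 2

  size : ∑[ g < n ] card (D g) ≤ k * n + ⌊ n /2⌋ + χ b
  size = begin
    ∑[ g < n ] card (D g)                 ≤⟨ sum-card≤ {m} {k} odd (ℕ.≤-reflexive (card-full k 2)) (λ r → ℕ.≤-reflexive (card-L r)) ⟩
    k * n + ∑[ g < n ] odd (q g) + χ b    ≡⟨ cong (λ z → k * n + z + χ b) (sum-odd n even) ⟩
    k * n + ⌊ n /2⌋ + χ b                 ∎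
    where open ℕ.≤-Reasoning

  upper : (3≤n : 3 ≤ n) → γₛ (C n 3≤n) (C (3 * k + 2) (3≤3k+ 2 1≤k)) ≤ k * n + ⌊ n /2⌋ + χ b
  upper 3≤n = ℕ.≤-trans (γₛ-upper 3≤n (3≤3k+ 2 1≤k) f D covers) size

-- Combining the bounds.

≤+1-split : ∀ {a c} → c ≤ a → a ≤ c + 1 → a ≡ c ⊎ a ≡ c + 1
≤+1-split {a} {c} c≤a a≤c+1 with ℕ.m≤n⇒m<n∨m≡n c≤a
... | inj₁ c<a = inj₂ (ℕ.≤-antisym a≤c+1 (subst (_≤ a) (ℕ.+-comm 1 c) c<a))
... | inj₂ c≡a = inj₁ (sym c≡a)

theorem3p1 : ∀ n k (3≤n : 3 ≤ n) (1≤k : 1 ≤ k) →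
    let γₛ[C] : ℕ → ℕ
        γₛ[C] p = γₛ (C n 3≤n) (C (3 * k + p) (3≤3k+ p 1≤k))
    in γₛ[C] 0 ≡ k * n
     × (γₛ[C] 1 ≡ k * n ⊎ γₛ[C] 1 ≡ k * n + 1)
     × (γₛ[C] 2 ≡ k * n + ⌊ n /2⌋ ⊎ γₛ[C] 2 ≡ k * n + ⌊ n /2⌋ + 1)
     × (n % 4 ≡ 0 → γₛ[C] 1 ≡ k * n × γₛ[C] 2 ≡ k * n + ⌊ n /2⌋)
theorem3p1 n k 3≤n 1≤k =
    ℕ.≤-antisym (upper₀ 3≤n 1≤k) (γₛ-≥ 0)
  , ≤+1-split (γₛ-≥ 1) (RemainderOne.upper 1≤k true (inj₁ refl) 3≤n)
  , ≤+1-split γₛ₂-≥ (let _ , even , lowered = lowered-start n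
                     in RemainderTwo.upper 1≤k true even lowered (inj₁ refl) 3≤n)
  -- The phases close up, so the flag is `false`: no layer is exceptional and the additional vertex
  -- is saved.
  , λ 4∣n → let closed = phase-q₀-%4 n 4∣n in
      ℕ.≤-antisym (drop-0 (RemainderOne.upper 1≤k false (inj₂ closed) 3≤n)) (γₛ-≥ 1)
    , ℕ.≤-antisym (drop-0 (RemainderTwo.upper 1≤k false even₀ (cong raised closed) (inj₂ closed) 3≤n)) γₛ₂-≥
  where
  γₛ-≥ : ∀ p → k * n ≤ γₛ (C n 3≤n) (C (3 * k + p) (3≤3k+ p 1≤k))
  γₛ-≥ p = γₛ-lower 3≤n (3≤3k+ p 1≤k) λ _ _ → k*n≤size {k = k} p

  γₛ₂-≥ : k * n + ⌊ n /2⌋ ≤ γₛ (C n 3≤n) (C (3 * k + 2) (3≤3k+ 2 1≤k))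
  γₛ₂-≥ = γₛ-lower 3≤n (3≤3k+ 2 1≤k) λ _ _ → k*n+⌊n/2⌋≤size {k = k}

  drop-0 : ∀ {a c} → a ≤ c + 0 → a ≤ c
  drop-0 {c = c} = subst (_ ≤_) (ℕ.+-identityʳ c)
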